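{- The following scheme, in which $\ell$ is a free parameter, is a non-commutative algorithm computing the product $AB=C$ of two generic $5\times5$ matrices $A=(a_{ij})$, $B=(b_{ij})$, $C=(c_{ij})$, $1\le i,j\le5$, using $99$ coefficient multiplications $m_1,\dots,m_{99}$. The products are $$\begin{aligned} m_{1}&=(a_{51}+a_{35}+a_{45}-a_{55})\,b_{54},\\ m_{2}&=(-a_{12}+a_{14})\,b_{21},\\ m_{3}&=-a_{32}\,b_{23},\\ m_{4}&=-a_{34}\,b_{43},\\ m_{5}&=a_{14}(b_{21}+b_{41}),\\ m_{6}&=(-a_{32}+a_{42})(b_{14}-b_{24}+b_{34}-b_{44}),\\ m_{7}&=(a_{12}+a_{32}-a_{14})(b_{21}+b_{41}+b_{43}),\\ m_{8}&=a_{53}\,b_{35}\,\ell,\\ m_{9}&=a_{51}\,b_{15}\,\ell,\\ m_{10}&=(-a_{43}+a_{34}-a_{44})(b_{21}-b_{41}+b_{12}-b_{22}-b_{32}+b_{42}),\\ m_{11}&=(a_{21}-a_{12}+a_{22}+a_{23}-a_{14}+a_{24})(-b_{43}-b_{34}+b_{44}),\\ m_{12}&=(a_{32}-a_{42}-a_{14}+a_{24})(b_{12}-b_{22}+b_{14}-b_{24}+b_{34}-b_{44}),\\ m_{13}&=(-a_{21}+a_{12}-a_{22})(-b_{23}+b_{43}-b_{14}+b_{24}+b_{34}-b_{44}),\\ m_{14}&=a_{45}(b_{32}-b_{42}+b_{52}),\\ m_{15}&=(a_{12}-a_{21}-a_{22}-a_{43}+a_{34}-a_{44})(b_{22}-b_{21}-b_{12}+b_{44}-b_{43}-b_{34}),\\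 m_{16}&=(-a_{41}+a_{32}-a_{42}-a_{43}+a_{34}-a_{44})(-b_{21}-b_{12}+b_{22}),\\ m_{17}&=(-a_{23}-a_{25})(-b_{53}+b_{54}),\\ m_{18}&=(a_{43}+a_{44})(b_{21}-b_{41}-b_{22}+b_{42}),\\ m_{19}&=(-a_{21}-a_{22}-a_{23}-a_{24})(-b_{43}+b_{44}),\\ m_{20}&=(a_{14}-a_{24})(b_{12}-b_{22}+b_{32}-b_{42}+b_{14}-b_{24}+b_{34}-b_{44}),\\ m_{21}&=(a_{21}+a_{22})(-b_{23}+b_{43}+b_{24}-b_{44}),\\ m_{22}&=(-a_{12}-a_{32}+a_{14}+a_{34})(b_{41}+b_{43}),\\ m_{23}&=(a_{12}+a_{32})(b_{21}+b_{41}+b_{23}+b_{43}),\\ m_{24}&=(a_{12}-a_{22}-a_{32}+a_{42}-a_{25})(b_{12}-b_{22}),\\ m_{25}&=(-a_{31}+a_{41}-a_{32}+a_{42})(b_{14}+b_{34}),\\ m_{26}&=(-a_{41}-a_{43})(-b_{13}+b_{23}+b_{14}-b_{24}),\\ m_{27}&=a_{35}(b_{32}+b_{52}),\\ m_{28}&=(-a_{54}-a_{45})(b_{32}-b_{42}+b_{52}+b_{54}),\\ m_{29}&=(a_{21}+a_{22}+a_{43}+a_{44})(-b_{21}+b_{22}-b_{43}+b_{44}),\\ m_{30}&=(a_{41}+a_{42}+a_{43}+a_{44})(-b_{21}+b_{22}),\\ m_{31}&=-a_{52}(b_{25}+b_{45}),\\ m_{32}&=(\ell a_{31}+a_{51}-\ell^2a_{35})(b_{11}+\tfrac{b_{51}}{\ell}-\ell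 b_{15}),\\ m_{33}&=(a_{23}+a_{25}+a_{45})(b_{53}-b_{54}-b_{35}+b_{45}),\\ m_{34}&=(\ell a_{13}+a_{53}-\ell^2a_{15})(b_{31}+\tfrac{b_{51}}{\ell}-\ell b_{35}),\\ m_{35}&=(a_{52}-a_{54})\,b_{45},\\ m_{36}&=(a_{14}-a_{23}+a_{43}-a_{24}-a_{34}+a_{44})(b_{42}-b_{41}-b_{32}-b_{43}-b_{34}+b_{44}),\\ m_{37}&=-a_{52}(b_{14}-b_{24}+b_{54}),\\ m_{38}&=(a_{21}+a_{41}+a_{43})(b_{31}-b_{41}-b_{32}+b_{42}-b_{13}+b_{23}+b_{14}-b_{24}),\\ m_{39}&=(a_{53}+a_{54}-a_{35})(b_{32}+b_{52}+b_{54}),\\ m_{40}&=(-\tfrac{a_{11}}{\ell}-\tfrac{a_{51}}{\ell^2}+a_{15})(b_{13}+\tfrac{b_{53}}{\ell}-\ell b_{15}),\\ m_{41}&=(a_{21}-a_{41}-a_{12}+a_{22}+a_{32}-a_{42})(b_{24}-b_{21}-b_{12}+b_{22}-b_{23}-b_{14}),\\ m_{42}&=a_{25}(b_{12}-b_{22}+b_{52}),\\ m_{43}&=-a_{54}(b_{32}-b_{42}+b_{52}+b_{34}-b_{44}+b_{54}),\\ m_{44}&=(a_{31}-a_{41}+a_{32}-a_{42}-a_{13}+a_{23}-a_{14}+a_{24})(b_{12}+b_{14}+b_{34}),\\ m_{45}&=(-a_{52}-a_{25})(b_{12}-b_{22}-b_{54}),\\ m_{46}&=(\ell a_{33}+a_{53}-\ell^2a_{35})(b_{33}+\tfrac{b_{53}}{\ell}-\ell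 b_{35}),\\ m_{47}&=(a_{52}+a_{14})(b_{21}-b_{45}),\\ m_{48}&=(\tfrac{a_{31}}{\ell}+\tfrac{a_{51}}{\ell^2})(b_{11}+\tfrac{b_{51}}{\ell}),\\ m_{49}&=a_{45}(-b_{53}+b_{54}-b_{15}+b_{25}+b_{55}),\\ m_{50}&=(-\ell a_{31}+\ell^2a_{35})(b_{11}-\ell b_{15}), \end{aligned}$$ $$\begin{aligned} m_{51}&=(a_{21}-a_{45})(-b_{51}+b_{52}+b_{15}-b_{25}),\\ m_{52}&=-a_{21}(b_{11}-b_{21}-b_{51}-b_{12}+b_{22}+b_{52}-b_{13}+b_{23}+b_{14}-b_{24}),\\ m_{53}&=(a_{21}+a_{25})(b_{51}-b_{52}),\\ m_{54}&=(\tfrac{a_{13}}{\ell}+\tfrac{a_{53}}{\ell^2})(b_{31}+\tfrac{b_{51}}{\ell}),\\ m_{55}&=(a_{52}-a_{34}-a_{54})(b_{23}+b_{25}+b_{45}),\\ m_{56}&=(-\ell a_{13}+\ell^2a_{15})(b_{31}-\ell b_{35}),\\ m_{57}&=(a_{23}+a_{43}+a_{25}+a_{45})(b_{35}-b_{45}),\\ m_{58}&=(a_{23}-a_{43}+a_{24}-a_{44})(-b_{41}+b_{42}-b_{43}+b_{44}),\\ m_{59}&=(-a_{41}-a_{45})(-b_{15}+b_{25}),\\ m_{60}&=(a_{13}-a_{23}+a_{14}-a_{24})(b_{12}+b_{32}+b_{14}+b_{34}),\\ m_{61}&=(a_{53}+a_{54})(b_{32}+b_{52}+b_{34}+b_{54}),\\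 m_{62}&=(a_{21}+a_{41}+a_{23}+a_{43})(b_{31}-b_{41}-b_{32}+b_{42}),\\ m_{63}&=(-a_{21}+a_{41}-a_{22}+a_{42})(-b_{21}+b_{22}-b_{23}+b_{24}),\\ m_{64}&=(\tfrac{a_{11}}{\ell}+\tfrac{a_{51}}{\ell^2})(b_{13}+\tfrac{b_{53}}{\ell}),\\ m_{65}&=(-a_{32}+a_{42}+a_{34}-a_{44}+a_{54})(b_{34}-b_{44}),\\ m_{66}&=(-\ell a_{11}+\ell^2a_{15})(b_{13}-\ell b_{15}),\\ m_{67}&=a_{15}(b_{12}+b_{52}),\\ m_{68}&=(a_{51}+a_{52})(b_{14}+b_{54}),\\ m_{69}&=(-\ell a_{33}+\ell^2a_{35})(b_{33}-\ell b_{35}),\\ m_{70}&=(-a_{53}-a_{15}-a_{25}+a_{55})(b_{52}+b_{54}),\\ m_{71}&=(\tfrac{a_{33}}{\ell}+\tfrac{a_{53}}{\ell^2})(b_{33}+\tfrac{b_{53}}{\ell}),\\ m_{72}&=(-a_{14}+a_{24}+a_{34}-a_{44}-a_{45})(b_{32}-b_{42}),\\ m_{73}&=(a_{11}-a_{21}-a_{31}+a_{41}+a_{12}-a_{22}-a_{32}+a_{42}-a_{15})\,b_{12},\\ m_{74}&=(a_{12}-a_{22}+a_{52}-a_{14}+a_{24})(b_{12}-b_{22}+b_{14}-b_{24}),\\ m_{75}&=(a_{51}+a_{52}-a_{15})(b_{12}-b_{54}),\\ m_{76}&=(a_{21}+a_{41})(b_{11}-b_{21}-b_{31}+b_{41}-b_{12}+b_{22}+b_{32}-b_{42}-b_{15}+b_{25}),\\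 m_{77}&=a_{33}\,b_{31},\\ m_{78}&=a_{11}\,b_{11},\\ m_{79}&=(-a_{13}+a_{23}+a_{33}-a_{43}-a_{14}+a_{24}+a_{34}-a_{44}-a_{35})\,b_{32},\\ m_{80}&=(a_{14}+a_{54})(b_{41}+b_{45}),\\ m_{81}&=(-a_{31}-\tfrac{a_{51}}{\ell}-a_{13}-\tfrac{a_{53}}{\ell}+\ell a_{15}+\ell a_{35}+a_{55})\,b_{51},\\ m_{82}&=a_{23}(-b_{31}+b_{41}+b_{32}-b_{42}+b_{33}-b_{43}-b_{53}-b_{34}+b_{44}+b_{54}),\\ m_{83}&=a_{13}\,b_{33},\\ m_{84}&=(a_{11}-a_{21}-a_{51}+a_{12}-a_{22}-a_{52}-a_{13}+a_{23}-a_{14}+a_{24})(b_{12}+b_{14}),\\ m_{85}&=(a_{34}+a_{54})(b_{23}+b_{43}+b_{25}+b_{45}),\\ m_{86}&=(-a_{11}-\tfrac{a_{51}}{\ell}-a_{33}-\tfrac{a_{53}}{\ell}+\ell a_{15}+\ell a_{35}+a_{55})\,b_{53},\\ m_{87}&=a_{43}(-b_{13}+b_{23}+b_{33}-b_{43}+b_{14}-b_{24}-b_{34}+b_{44}-b_{35}+b_{45}),\\ m_{88}&=a_{31}\,b_{13},\\ m_{89}&=a_{15}(-b_{31}-\tfrac{b_{51}}{\ell}-b_{13}-\tfrac{b_{53}}{\ell}+\ell b_{15}+\ell b_{35}+b_{55}),\\ m_{90}&=(-a_{31}+a_{41}-a_{32}+a_{42}+a_{33}-a_{43}-a_{53}+a_{34}-a_{44}-a_{54})\,b_{34},\\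 m_{91}&=a_{55}\,b_{55},\\ m_{92}&=(a_{43}+a_{44})\,b_{45},\\ m_{93}&=(a_{41}+a_{42})\,b_{25},\\ m_{94}&=(a_{32}+a_{52}-a_{34}-a_{54})(b_{23}+b_{25}),\\ m_{95}&=-a_{35}(b_{11}+\tfrac{b_{51}}{\ell}+b_{33}+\tfrac{b_{53}}{\ell}-\ell b_{15}-\ell b_{35}-b_{55}),\\ m_{96}&=(a_{23}+a_{24})\,b_{45},\\ m_{97}&=(a_{21}+a_{22})\,b_{25},\\ m_{98}&=(a_{25}+a_{45})(-b_{51}+b_{52}-b_{35}+b_{45}+b_{55}),\\ m_{99}&=(a_{12}+a_{52})(b_{21}+b_{25}). \end{aligned}$$ The entries of $C$ are $$\begin{aligned} c_{11}&=-\tfrac{m_{8}}{\ell}-m_{2}+m_{5}+m_{78}+\ell m_{54}-\tfrac{m_{56}}{\ell}-\tfrac{m_{34}}{\ell},\\ c_{21}&=m_{10}+m_{11}+m_{12}-m_{2}+m_{5}+m_{6}-m_{52}+m_{53}+m_{62}+m_{36}-m_{38}+m_{42}+m_{15}+m_{20}+m_{24}-m_{26},\\ c_{31}&=m_{7}-\tfrac{m_{9}}{\ell}+m_{2}+m_{4}+m_{77}-\tfrac{m_{50}}{\ell}-\tfrac{m_{32}}{\ell}+\ell m_{48}+m_{22},\\ c_{41}&=m_{7}+m_{10}+m_{12}+m_{14}+m_{2}+m_{4}+m_{6}+m_{72}+m_{76}+m_{51}+m_{52}+m_{59}+m_{38}+m_{16}+m_{20}+m_{22}+m_{26},\\ c_{51}&=m_{8}+m_{9}-m_{5}+m_{80}+m_{81}+m_{50}+m_{56}+m_{32}+m_{34}+m_{35}+m_{47},\\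 c_{12}&=m_{10}+m_{11}-m_{2}+m_{5}+m_{67}+m_{73}+m_{58}+m_{60}+m_{36}+m_{44}+m_{15}+m_{18}+m_{19}+m_{25}+m_{29},\\ c_{22}&=m_{10}+m_{11}+m_{12}-m_{2}+m_{5}+m_{6}+m_{58}+m_{36}+m_{42}+m_{15}+m_{18}+m_{19}+m_{20}+m_{24}+m_{29},\\ c_{32}&=m_{7}+m_{10}+m_{2}+m_{4}+m_{79}+m_{60}+m_{44}+m_{16}+m_{18}+m_{22}+m_{25}+m_{27}+m_{30},\\ c_{42}&=m_{7}+m_{10}+m_{12}+m_{14}+m_{2}+m_{4}+m_{6}+m_{72}+m_{16}+m_{18}+m_{20}+m_{22}+m_{30},\\ c_{52}&=m_{14}+m_{1}+m_{67}+m_{70}+m_{75}+m_{39}+m_{42}+m_{45}+m_{27}+m_{28},\\ c_{13}&=-m_{7}-\tfrac{m_{9}}{\ell}+m_{3}-m_{5}+m_{83}-\tfrac{m_{66}}{\ell}+\ell m_{64}+\ell m_{40}+m_{23},\\ c_{23}&=-m_{7}-m_{11}-m_{12}+m_{13}+m_{3}-m_{5}-m_{6}+m_{74}+m_{82}+m_{62}+m_{37}-m_{38}+m_{45}+m_{17}+m_{23}-m_{24}-m_{26},\\ c_{33}&=-\tfrac{m_{8}}{\ell}-m_{3}-m_{4}+m_{88}-\tfrac{m_{69}}{\ell}+\ell m_{71}-\tfrac{m_{46}}{\ell},\\ c_{43}&=m_{13}-m_{14}-m_{3}-m_{4}-m_{6}+m_{87}+m_{57}+m_{65}+m_{33}+m_{41}+m_{43}+m_{15}-m_{16}-m_{17}+m_{26}-m_{28},\\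 c_{53}&=m_{8}+m_{9}+m_{4}+m_{85}+m_{86}+m_{66}+m_{69}+m_{55}-\ell^2m_{40}+m_{46}+m_{31},\\ c_{14}&=-m_{7}-m_{11}+m_{13}+m_{3}-m_{5}+m_{84}+m_{68}-m_{73}+m_{75}-m_{44}-m_{19}+m_{21}+m_{23}-m_{25},\\ c_{24}&=-m_{7}-m_{11}-m_{12}+m_{13}+m_{3}-m_{5}-m_{6}+m_{74}+m_{37}+m_{45}-m_{19}+m_{21}+m_{23}-m_{24},\\ c_{34}&=m_{13}-m_{3}-m_{4}+m_{90}+m_{61}+m_{63}-m_{39}+m_{41}+m_{15}-m_{16}+m_{21}-m_{25}-m_{27}+m_{29}-m_{30},\\ c_{44}&=m_{13}-m_{14}-m_{3}-m_{4}-m_{6}+m_{63}+m_{65}+m_{41}+m_{43}+m_{15}-m_{16}+m_{21}-m_{28}+m_{29}-m_{30},\\ c_{54}&=-m_{14}-m_{1}+m_{68}+m_{61}+m_{37}-m_{39}+m_{43}-m_{27}-m_{28},\\ c_{15}&=-\tfrac{m_{8}}{\ell^2}-\tfrac{m_{9}}{\ell^2}-\tfrac{m_{34}}{\ell^2}+m_{2}+m_{89}+m_{99}+m_{54}+m_{64}+m_{40}-m_{47}+m_{31},\\ c_{25}&=m_{96}+m_{97}+m_{98}-m_{49}+m_{51}+m_{53}-m_{33}+m_{17},\\ c_{35}&=-\tfrac{m_{8}}{\ell^2}-\tfrac{m_{9}}{\ell^2}-\tfrac{m_{46}}{\ell^2}-\tfrac{m_{32}}{\ell^2}+m_{3}+m_{94}+m_{95}+m_{71}-m_{55}+m_{35}+m_{48},\\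 c_{45}&=m_{92}+m_{93}+m_{49}+m_{57}+m_{59}+m_{33}-m_{17},\\ c_{55}&=\tfrac{m_{8}}{\ell}+\tfrac{m_{9}}{\ell}+m_{91}-m_{35}-m_{31}. \end{aligned}$$
   Context: The matrices $A$ and $B$ are generic $5\times5$ matrices with entries $a_{ij}$ and $b_{ij}$, and $C=AB$ means $c_{ij}=\sum_{k=1}^5a_{ik}b_{kj}$. "Non-commutative" means that the entries of the matrices are not assumed to commute with one another. Each $m_r$ is a linear combination of entries of $A$ times (in this order) a linear combination of entries of $B$, and each such product counts as one coefficient multiplication; multiplications by scalar coefficients, including powers of the scalar parameter $\ell$, are not counted. Since the formulas contain $1/\ell$ and $1/\ell^2$, the parameter $\ell$ is understood to be invertible. -}

module Defs where

open import Algebra.Bundles using (Ring; CommutativeRing)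
open import Algebra.Morphism.Structures using (IsRingHomomorphism)
open import Data.Fin.Base using (Fin; zero; suc; fromℕ<)
open import Data.Nat.Base using (ℕ; NonZero)
open import Data.Nat.Properties using (_≤?_)
open import Data.Product.Base using (_×_; _,_)
open import Data.Vec.Base using (Vec; []; _∷_; lookup)
open import Level using (Level; _⊔_) renaming (suc to lsuc)
open import Relation.Nullary.Decidable.Core using (True; toWitness)
import Algebra.Properties.Monoid.Sum as MonoidSum

private
  variable
    k e r e′ s : Level

infix  6 _⊗_
infixl 7 _+_ _-_
infix  8 -_
infixr 9 _•_

-- Formal linear combinations of the variables X with coefficients in S.
data Linear (S : Set s) (X : Set) : Set s where
  var : X → Linear S X
  _+_ : Linear S X → Linear S X → Linear S X
  _-_ : Linear S X → Linear S X → Linear S X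
  -_  : Linear S X → Linear S X
  _•_ : S → Linear S X → Linear S X

-- A coefficient multiplication for an m × n matrix times an n × p matrix: a linear
-- combination of entries of the left factor times one of entries of the right factor.
data Product (S : Set s) (m n p : ℕ) : Set s where
  _⊗_ : Linear S (Fin m × Fin n) → Linear S (Fin n × Fin p) → Product S m n p

-- A bilinear scheme with t coefficient multiplications; scalar coefficients are not counted.
record Scheme (S : Set s) (m n p t : ℕ) : Set s where
  field
    products : Vec (Product S m n p) t
    outputs  : Fin m → Fin p → Linear S (Fin t)

-- Associative unital K-algebras, not necessarily commutative; c ∈ K acts as
-- multiplication by the central element η c.
record AssociativeAlgebra (K : CommutativeRing k e) (r e′ : Level)
  : Set (k ⊔ e ⊔ lsuc (r ⊔ e′)) where
  private module K = CommutativeRing K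
  field
    ring : Ring r e′
  open Ring ring
  field
    η                  : K.Carrier → Carrier
    isRingHomomorphism : IsRingHomomorphism (Ring.rawRing K.ring) rawRing η
    central            : ∀ c x → η c * x ≈ x * η c

module Evaluation {K : CommutativeRing k e} (R : AssociativeAlgebra K r e′) where
  private module K = CommutativeRing K
  open AssociativeAlgebra R using (ring; η)
  private module R = Ring ring
  open MonoidSum R.+-monoid using (sum-syntax)

  Matrix : ℕ → ℕ → Set r
  Matrix m n = Fin m → Fin n → R.Carrier

  evalLinear : {X : Set} → (X → R.Carrier) → Linear K.Carrier X → R.Carrier
  evalLinear ρ (var x) = ρ x
  evalLinear ρ (u + v) = evalLinear ρ u R.+ evalLinear ρ v
  evalLinear ρ (u - v) = evalLinear ρ u R.- evalLinear ρ v
  evalLinear ρ (- u)   = R.- evalLinear ρ u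
  evalLinear ρ (c • u) = η c R.* evalLinear ρ u

  module _ {m n p : ℕ} (A : Matrix m n) (B : Matrix n p) where

    evalProduct : Product K.Carrier m n p → R.Carrier
    evalProduct (u ⊗ v) =
      evalLinear (λ (i , j) → A i j) u R.* evalLinear (λ (i , j) → B i j) v

    evalScheme : ∀ {t} → Scheme K.Carrier m n p t → Matrix m p
    evalScheme σ i j = evalLinear (λ q → evalProduct (lookup products q)) (outputs i j)
      where open Scheme σ

    matrixProduct : Matrix m p
    matrixProduct i j = ∑[ h < n ] (A i h R.* B h j)

-- The scheme is a non-commutative algorithm for matrix multiplication: it is correct on
-- all matrices over all associative K-algebras (in given universes).
ComputesMatrixProduct : (K : CommutativeRing k e) (r e′ : Level) {m n p t : ℕ} →
                        Scheme (CommutativeRing.Carrier K) m n p t →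
                        Set (k ⊔ e ⊔ lsuc (r ⊔ e′))
ComputesMatrixProduct K r e′ {m} {n} {p} σ =
  (R : AssociativeAlgebra K r e′) → let open Evaluation R; open Ring (AssociativeAlgebra.ring R) in
  (A : Matrix m n) (B : Matrix n p) (i : Fin m) (j : Fin p) →
  evalScheme A B σ i j ≈ matrixProduct A B i j

-- 1-based indices.
pattern ₁ = zero
pattern ₂ = suc zero
pattern ₃ = suc (suc zero)
pattern ₄ = suc (suc (suc zero))
pattern ₅ = suc (suc (suc (suc zero)))

module Scheme99 (K : CommutativeRing k e) (ℓ ℓ⁻¹ : CommutativeRing.Carrier K) where
  private module K = CommutativeRing K

  ℓ² ℓ⁻² : K.Carrier
  ℓ²  = ℓ K.* ℓ
  ℓ⁻² = ℓ⁻¹ K.* ℓ⁻¹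

  a b : Fin 5 → Fin 5 → Linear K.Carrier (Fin 5 × Fin 5)
  a i j = var (i , j)
  b i j = var (i , j)

  -- m q refers to the q-th product, counting from 1.
  m : (q : ℕ) .{{_ : NonZero q}} {q≤99 : True (q ≤? 99)} → Linear K.Carrier (Fin 99)
  m (ℕ.suc _) {q≤99} = var (fromℕ< (toWitness q≤99))

  -- Scalars are absorbed into the linear factors: the trailing ℓ of m₈ = a₅₃ b₃₅ ℓ and
  -- m₉ = a₅₁ b₁₅ ℓ into the right one, a leading minus sign into the left one.
  products : Vec (Product K.Carrier 5 5 5) 99
  products =
    -- m₁ to m₁₀
    (a ₅ ₁ + a ₃ ₅ + a ₄ ₅ - a ₅ ₅) ⊗ b ₅ ₄ ∷
    (- a ₁ ₂ + a ₁ ₄) ⊗ b ₂ ₁ ∷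
    - a ₃ ₂ ⊗ b ₂ ₃ ∷
    - a ₃ ₄ ⊗ b ₄ ₃ ∷
    a ₁ ₄ ⊗ (b ₂ ₁ + b ₄ ₁) ∷
    (- a ₃ ₂ + a ₄ ₂) ⊗ (b ₁ ₄ - b ₂ ₄ + b ₃ ₄ - b ₄ ₄) ∷
    (a ₁ ₂ + a ₃ ₂ - a ₁ ₄) ⊗ (b ₂ ₁ + b ₄ ₁ + b ₄ ₃) ∷
    a ₅ ₃ ⊗ ℓ • b ₃ ₅ ∷
    a ₅ ₁ ⊗ ℓ • b ₁ ₅ ∷
    (- a ₄ ₃ + a ₃ ₄ - a ₄ ₄) ⊗ (b ₂ ₁ - b ₄ ₁ + b ₁ ₂ - b ₂ ₂ - b ₃ ₂ + b ₄ ₂) ∷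
    -- m₁₁ to m₂₀
    (a ₂ ₁ - a ₁ ₂ + a ₂ ₂ + a ₂ ₃ - a ₁ ₄ + a ₂ ₄) ⊗ (- b ₄ ₃ - b ₃ ₄ + b ₄ ₄) ∷
    (a ₃ ₂ - a ₄ ₂ - a ₁ ₄ + a ₂ ₄) ⊗ (b ₁ ₂ - b ₂ ₂ + b ₁ ₄ - b ₂ ₄ + b ₃ ₄ - b ₄ ₄) ∷
    (- a ₂ ₁ + a ₁ ₂ - a ₂ ₂) ⊗ (- b ₂ ₃ + b ₄ ₃ - b ₁ ₄ + b ₂ ₄ + b ₃ ₄ - b ₄ ₄) ∷
    a ₄ ₅ ⊗ (b ₃ ₂ - b ₄ ₂ + b ₅ ₂) ∷
    (a ₁ ₂ - a ₂ ₁ - a ₂ ₂ - a ₄ ₃ + a ₃ ₄ - a ₄ ₄)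
      ⊗ (b ₂ ₂ - b ₂ ₁ - b ₁ ₂ + b ₄ ₄ - b ₄ ₃ - b ₃ ₄) ∷
    (- a ₄ ₁ + a ₃ ₂ - a ₄ ₂ - a ₄ ₃ + a ₃ ₄ - a ₄ ₄) ⊗ (- b ₂ ₁ - b ₁ ₂ + b ₂ ₂) ∷
    (- a ₂ ₃ - a ₂ ₅) ⊗ (- b ₅ ₃ + b ₅ ₄) ∷
    (a ₄ ₃ + a ₄ ₄) ⊗ (b ₂ ₁ - b ₄ ₁ - b ₂ ₂ + b ₄ ₂) ∷
    (- a ₂ ₁ - a ₂ ₂ - a ₂ ₃ - a ₂ ₄) ⊗ (- b ₄ ₃ + b ₄ ₄) ∷
    (a ₁ ₄ - a ₂ ₄) ⊗ (b ₁ ₂ - b ₂ ₂ + b ₃ ₂ - b ₄ ₂ + b ₁ ₄ - b ₂ ₄ + b ₃ ₄ - b ₄ ₄) ∷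
    -- m₂₁ to m₃₀
    (a ₂ ₁ + a ₂ ₂) ⊗ (- b ₂ ₃ + b ₄ ₃ + b ₂ ₄ - b ₄ ₄) ∷
    (- a ₁ ₂ - a ₃ ₂ + a ₁ ₄ + a ₃ ₄) ⊗ (b ₄ ₁ + b ₄ ₃) ∷
    (a ₁ ₂ + a ₃ ₂) ⊗ (b ₂ ₁ + b ₄ ₁ + b ₂ ₃ + b ₄ ₃) ∷
    (a ₁ ₂ - a ₂ ₂ - a ₃ ₂ + a ₄ ₂ - a ₂ ₅) ⊗ (b ₁ ₂ - b ₂ ₂) ∷
    (- a ₃ ₁ + a ₄ ₁ - a ₃ ₂ + a ₄ ₂) ⊗ (b ₁ ₄ + b ₃ ₄) ∷
    (- a ₄ ₁ - a ₄ ₃) ⊗ (- b ₁ ₃ + b ₂ ₃ + b ₁ ₄ - b ₂ ₄) ∷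
    a ₃ ₅ ⊗ (b ₃ ₂ + b ₅ ₂) ∷
    (- a ₅ ₄ - a ₄ ₅) ⊗ (b ₃ ₂ - b ₄ ₂ + b ₅ ₂ + b ₅ ₄) ∷
    (a ₂ ₁ + a ₂ ₂ + a ₄ ₃ + a ₄ ₄) ⊗ (- b ₂ ₁ + b ₂ ₂ - b ₄ ₃ + b ₄ ₄) ∷
    (a ₄ ₁ + a ₄ ₂ + a ₄ ₃ + a ₄ ₄) ⊗ (- b ₂ ₁ + b ₂ ₂) ∷
    -- m₃₁ to m₄₀
    - a ₅ ₂ ⊗ (b ₂ ₅ + b ₄ ₅) ∷
    (ℓ • a ₃ ₁ + a ₅ ₁ - ℓ² • a ₃ ₅) ⊗ (b ₁ ₁ + ℓ⁻¹ • b ₅ ₁ - ℓ • b ₁ ₅) ∷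
    (a ₂ ₃ + a ₂ ₅ + a ₄ ₅) ⊗ (b ₅ ₃ - b ₅ ₄ - b ₃ ₅ + b ₄ ₅) ∷
    (ℓ • a ₁ ₃ + a ₅ ₃ - ℓ² • a ₁ ₅) ⊗ (b ₃ ₁ + ℓ⁻¹ • b ₅ ₁ - ℓ • b ₃ ₅) ∷
    (a ₅ ₂ - a ₅ ₄) ⊗ b ₄ ₅ ∷
    (a ₁ ₄ - a ₂ ₃ + a ₄ ₃ - a ₂ ₄ - a ₃ ₄ + a ₄ ₄)
      ⊗ (b ₄ ₂ - b ₄ ₁ - b ₃ ₂ - b ₄ ₃ - b ₃ ₄ + b ₄ ₄) ∷
    - a ₅ ₂ ⊗ (b ₁ ₄ - b ₂ ₄ + b ₅ ₄) ∷
    (a ₂ ₁ + a ₄ ₁ + a ₄ ₃) ⊗ (b ₃ ₁ - b ₄ ₁ - b ₃ ₂ + b ₄ ₂ - b ₁ ₃ + b ₂ ₃ + b ₁ ₄ - b ₂ ₄) ∷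
    (a ₅ ₃ + a ₅ ₄ - a ₃ ₅) ⊗ (b ₃ ₂ + b ₅ ₂ + b ₅ ₄) ∷
    (- ℓ⁻¹ • a ₁ ₁ - ℓ⁻² • a ₅ ₁ + a ₁ ₅) ⊗ (b ₁ ₃ + ℓ⁻¹ • b ₅ ₃ - ℓ • b ₁ ₅) ∷
    -- m₄₁ to m₅₀
    (a ₂ ₁ - a ₄ ₁ - a ₁ ₂ + a ₂ ₂ + a ₃ ₂ - a ₄ ₂)
      ⊗ (b ₂ ₄ - b ₂ ₁ - b ₁ ₂ + b ₂ ₂ - b ₂ ₃ - b ₁ ₄) ∷
    a ₂ ₅ ⊗ (b ₁ ₂ - b ₂ ₂ + b ₅ ₂) ∷
    - a ₅ ₄ ⊗ (b ₃ ₂ - b ₄ ₂ + b ₅ ₂ + b ₃ ₄ - b ₄ ₄ + b ₅ ₄) ∷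
    (a ₃ ₁ - a ₄ ₁ + a ₃ ₂ - a ₄ ₂ - a ₁ ₃ + a ₂ ₃ - a ₁ ₄ + a ₂ ₄) ⊗ (b ₁ ₂ + b ₁ ₄ + b ₃ ₄) ∷
    (- a ₅ ₂ - a ₂ ₅) ⊗ (b ₁ ₂ - b ₂ ₂ - b ₅ ₄) ∷
    (ℓ • a ₃ ₃ + a ₅ ₃ - ℓ² • a ₃ ₅) ⊗ (b ₃ ₃ + ℓ⁻¹ • b ₅ ₃ - ℓ • b ₃ ₅) ∷
    (a ₅ ₂ + a ₁ ₄) ⊗ (b ₂ ₁ - b ₄ ₅) ∷
    (ℓ⁻¹ • a ₃ ₁ + ℓ⁻² • a ₅ ₁) ⊗ (b ₁ ₁ + ℓ⁻¹ • b ₅ ₁) ∷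
    a ₄ ₅ ⊗ (- b ₅ ₃ + b ₅ ₄ - b ₁ ₅ + b ₂ ₅ + b ₅ ₅) ∷
    (- ℓ • a ₃ ₁ + ℓ² • a ₃ ₅) ⊗ (b ₁ ₁ - ℓ • b ₁ ₅) ∷
    -- m₅₁ to m₆₀
    (a ₂ ₁ - a ₄ ₅) ⊗ (- b ₅ ₁ + b ₅ ₂ + b ₁ ₅ - b ₂ ₅) ∷
    - a ₂ ₁ ⊗ (b ₁ ₁ - b ₂ ₁ - b ₅ ₁ - b ₁ ₂ + b ₂ ₂ + b ₅ ₂ - b ₁ ₃ + b ₂ ₃ + b ₁ ₄ - b ₂ ₄) ∷
    (a ₂ ₁ + a ₂ ₅) ⊗ (b ₅ ₁ - b ₅ ₂) ∷
    (ℓ⁻¹ • a ₁ ₃ + ℓ⁻² • a ₅ ₃) ⊗ (b ₃ ₁ + ℓ⁻¹ • b ₅ ₁) ∷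
    (a ₅ ₂ - a ₃ ₄ - a ₅ ₄) ⊗ (b ₂ ₃ + b ₂ ₅ + b ₄ ₅) ∷
    (- ℓ • a ₁ ₃ + ℓ² • a ₁ ₅) ⊗ (b ₃ ₁ - ℓ • b ₃ ₅) ∷
    (a ₂ ₃ + a ₄ ₃ + a ₂ ₅ + a ₄ ₅) ⊗ (b ₃ ₅ - b ₄ ₅) ∷
    (a ₂ ₃ - a ₄ ₃ + a ₂ ₄ - a ₄ ₄) ⊗ (- b ₄ ₁ + b ₄ ₂ - b ₄ ₃ + b ₄ ₄) ∷
    (- a ₄ ₁ - a ₄ ₅) ⊗ (- b ₁ ₅ + b ₂ ₅) ∷
    (a ₁ ₃ - a ₂ ₃ + a ₁ ₄ - a ₂ ₄) ⊗ (b ₁ ₂ + b ₃ ₂ + b ₁ ₄ + b ₃ ₄) ∷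
    -- m₆₁ to m₇₀
    (a ₅ ₃ + a ₅ ₄) ⊗ (b ₃ ₂ + b ₅ ₂ + b ₃ ₄ + b ₅ ₄) ∷
    (a ₂ ₁ + a ₄ ₁ + a ₂ ₃ + a ₄ ₃) ⊗ (b ₃ ₁ - b ₄ ₁ - b ₃ ₂ + b ₄ ₂) ∷
    (- a ₂ ₁ + a ₄ ₁ - a ₂ ₂ + a ₄ ₂) ⊗ (- b ₂ ₁ + b ₂ ₂ - b ₂ ₃ + b ₂ ₄) ∷
    (ℓ⁻¹ • a ₁ ₁ + ℓ⁻² • a ₅ ₁) ⊗ (b ₁ ₃ + ℓ⁻¹ • b ₅ ₃) ∷
    (- a ₃ ₂ + a ₄ ₂ + a ₃ ₄ - a ₄ ₄ + a ₅ ₄) ⊗ (b ₃ ₄ - b ₄ ₄) ∷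
    (- ℓ • a ₁ ₁ + ℓ² • a ₁ ₅) ⊗ (b ₁ ₃ - ℓ • b ₁ ₅) ∷
    a ₁ ₅ ⊗ (b ₁ ₂ + b ₅ ₂) ∷
    (a ₅ ₁ + a ₅ ₂) ⊗ (b ₁ ₄ + b ₅ ₄) ∷
    (- ℓ • a ₃ ₃ + ℓ² • a ₃ ₅) ⊗ (b ₃ ₃ - ℓ • b ₃ ₅) ∷
    (- a ₅ ₃ - a ₁ ₅ - a ₂ ₅ + a ₅ ₅) ⊗ (b ₅ ₂ + b ₅ ₄) ∷
    -- m₇₁ to m₈₀
    (ℓ⁻¹ • a ₃ ₃ + ℓ⁻² • a ₅ ₃) ⊗ (b ₃ ₃ + ℓ⁻¹ • b ₅ ₃) ∷
    (- a ₁ ₄ + a ₂ ₄ + a ₃ ₄ - a ₄ ₄ - a ₄ ₅) ⊗ (b ₃ ₂ - b ₄ ₂) ∷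
    (a ₁ ₁ - a ₂ ₁ - a ₃ ₁ + a ₄ ₁ + a ₁ ₂ - a ₂ ₂ - a ₃ ₂ + a ₄ ₂ - a ₁ ₅) ⊗ b ₁ ₂ ∷
    (a ₁ ₂ - a ₂ ₂ + a ₅ ₂ - a ₁ ₄ + a ₂ ₄) ⊗ (b ₁ ₂ - b ₂ ₂ + b ₁ ₄ - b ₂ ₄) ∷
    (a ₅ ₁ + a ₅ ₂ - a ₁ ₅) ⊗ (b ₁ ₂ - b ₅ ₄) ∷
    (a ₂ ₁ + a ₄ ₁)
      ⊗ (b ₁ ₁ - b ₂ ₁ - b ₃ ₁ + b ₄ ₁ - b ₁ ₂ + b ₂ ₂ + b ₃ ₂ - b ₄ ₂ - b ₁ ₅ + b ₂ ₅) ∷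
    a ₃ ₃ ⊗ b ₃ ₁ ∷
    a ₁ ₁ ⊗ b ₁ ₁ ∷
    (- a ₁ ₃ + a ₂ ₃ + a ₃ ₃ - a ₄ ₃ - a ₁ ₄ + a ₂ ₄ + a ₃ ₄ - a ₄ ₄ - a ₃ ₅) ⊗ b ₃ ₂ ∷
    (a ₁ ₄ + a ₅ ₄) ⊗ (b ₄ ₁ + b ₄ ₅) ∷
    -- m₈₁ to m₉₀
    (- a ₃ ₁ - ℓ⁻¹ • a ₅ ₁ - a ₁ ₃ - ℓ⁻¹ • a ₅ ₃ + ℓ • a ₁ ₅ + ℓ • a ₃ ₅ + a ₅ ₅) ⊗ b ₅ ₁ ∷
    a ₂ ₃ ⊗ (- b ₃ ₁ + b ₄ ₁ + b ₃ ₂ - b ₄ ₂ + b ₃ ₃ - b ₄ ₃ - b ₅ ₃ - b ₃ ₄ + b ₄ ₄ + b ₅ ₄) ∷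
    a ₁ ₃ ⊗ b ₃ ₃ ∷
    (a ₁ ₁ - a ₂ ₁ - a ₅ ₁ + a ₁ ₂ - a ₂ ₂ - a ₅ ₂ - a ₁ ₃ + a ₂ ₃ - a ₁ ₄ + a ₂ ₄)
      ⊗ (b ₁ ₂ + b ₁ ₄) ∷
    (a ₃ ₄ + a ₅ ₄) ⊗ (b ₂ ₃ + b ₄ ₃ + b ₂ ₅ + b ₄ ₅) ∷
    (- a ₁ ₁ - ℓ⁻¹ • a ₅ ₁ - a ₃ ₃ - ℓ⁻¹ • a ₅ ₃ + ℓ • a ₁ ₅ + ℓ • a ₃ ₅ + a ₅ ₅) ⊗ b ₅ ₃ ∷
    a ₄ ₃ ⊗ (- b ₁ ₃ + b ₂ ₃ + b ₃ ₃ - b ₄ ₃ + b ₁ ₄ - b ₂ ₄ - b ₃ ₄ + b ₄ ₄ - b ₃ ₅ + b ₄ ₅) ∷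
    a ₃ ₁ ⊗ b ₁ ₃ ∷
    a ₁ ₅ ⊗ (- b ₃ ₁ - ℓ⁻¹ • b ₅ ₁ - b ₁ ₃ - ℓ⁻¹ • b ₅ ₃ + ℓ • b ₁ ₅ + ℓ • b ₃ ₅ + b ₅ ₅) ∷
    (- a ₃ ₁ + a ₄ ₁ - a ₃ ₂ + a ₄ ₂ + a ₃ ₃ - a ₄ ₃ - a ₅ ₃ + a ₃ ₄ - a ₄ ₄ - a ₅ ₄) ⊗ b ₃ ₄ ∷
    -- m₉₁ to m₉₉
    a ₅ ₅ ⊗ b ₅ ₅ ∷
    (a ₄ ₃ + a ₄ ₄) ⊗ b ₄ ₅ ∷
    (a ₄ ₁ + a ₄ ₂) ⊗ b ₂ ₅ ∷
    (a ₃ ₂ + a ₅ ₂ - a ₃ ₄ - a ₅ ₄) ⊗ (b ₂ ₃ + b ₂ ₅) ∷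
    - a ₃ ₅ ⊗ (b ₁ ₁ + ℓ⁻¹ • b ₅ ₁ + b ₃ ₃ + ℓ⁻¹ • b ₅ ₃ - ℓ • b ₁ ₅ - ℓ • b ₃ ₅ - b ₅ ₅) ∷
    (a ₂ ₃ + a ₂ ₄) ⊗ b ₄ ₅ ∷
    (a ₂ ₁ + a ₂ ₂) ⊗ b ₂ ₅ ∷
    (a ₂ ₅ + a ₄ ₅) ⊗ (- b ₅ ₁ + b ₅ ₂ - b ₃ ₅ + b ₄ ₅ + b ₅ ₅) ∷
    (a ₁ ₂ + a ₅ ₂) ⊗ (b ₂ ₁ + b ₂ ₅) ∷
    []

  c : Fin 5 → Fin 5 → Linear K.Carrier (Fin 99)
  c ₁ ₁ = - ℓ⁻¹ • m 8 - m 2 + m 5 + m 78 + ℓ • m 54 - ℓ⁻¹ • m 56 - ℓ⁻¹ • m 34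
  c ₂ ₁ = m 10 + m 11 + m 12 - m 2 + m 5 + m 6 - m 52 + m 53 + m 62 + m 36 - m 38 + m 42 + m 15
          + m 20 + m 24 - m 26
  c ₃ ₁ = m 7 - ℓ⁻¹ • m 9 + m 2 + m 4 + m 77 - ℓ⁻¹ • m 50 - ℓ⁻¹ • m 32 + ℓ • m 48 + m 22
  c ₄ ₁ = m 7 + m 10 + m 12 + m 14 + m 2 + m 4 + m 6 + m 72 + m 76 + m 51 + m 52 + m 59 + m 38
          + m 16 + m 20 + m 22 + m 26
  c ₅ ₁ = m 8 + m 9 - m 5 + m 80 + m 81 + m 50 + m 56 + m 32 + m 34 + m 35 + m 47
  c ₁ ₂ = m 10 + m 11 - m 2 + m 5 + m 67 + m 73 + m 58 + m 60 + m 36 + m 44 + m 15 + m 18 + m 19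
          + m 25 + m 29
  c ₂ ₂ = m 10 + m 11 + m 12 - m 2 + m 5 + m 6 + m 58 + m 36 + m 42 + m 15 + m 18 + m 19 + m 20
          + m 24 + m 29
  c ₃ ₂ = m 7 + m 10 + m 2 + m 4 + m 79 + m 60 + m 44 + m 16 + m 18 + m 22 + m 25 + m 27 + m 30
  c ₄ ₂ = m 7 + m 10 + m 12 + m 14 + m 2 + m 4 + m 6 + m 72 + m 16 + m 18 + m 20 + m 22 + m 30
  c ₅ ₂ = m 14 + m 1 + m 67 + m 70 + m 75 + m 39 + m 42 + m 45 + m 27 + m 28
  c ₁ ₃ = - m 7 - ℓ⁻¹ • m 9 + m 3 - m 5 + m 83 - ℓ⁻¹ • m 66 + ℓ • m 64 + ℓ • m 40 + m 23
  c ₂ ₃ = - m 7 - m 11 - m 12 + m 13 + m 3 - m 5 - m 6 + m 74 + m 82 + m 62 + m 37 - m 38 + m 45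
          + m 17 + m 23 - m 24 - m 26
  c ₃ ₃ = - ℓ⁻¹ • m 8 - m 3 - m 4 + m 88 - ℓ⁻¹ • m 69 + ℓ • m 71 - ℓ⁻¹ • m 46
  c ₄ ₃ = m 13 - m 14 - m 3 - m 4 - m 6 + m 87 + m 57 + m 65 + m 33 + m 41 + m 43 + m 15 - m 16
          - m 17 + m 26 - m 28
  c ₅ ₃ = m 8 + m 9 + m 4 + m 85 + m 86 + m 66 + m 69 + m 55 - ℓ² • m 40 + m 46 + m 31
  c ₁ ₄ = - m 7 - m 11 + m 13 + m 3 - m 5 + m 84 + m 68 - m 73 + m 75 - m 44 - m 19 + m 21
          + m 23 - m 25
  c ₂ ₄ = - m 7 - m 11 - m 12 + m 13 + m 3 - m 5 - m 6 + m 74 + m 37 + m 45 - m 19 + m 21 + m 23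
          - m 24
  c ₃ ₄ = m 13 - m 3 - m 4 + m 90 + m 61 + m 63 - m 39 + m 41 + m 15 - m 16 + m 21 - m 25 - m 27
          + m 29 - m 30
  c ₄ ₄ = m 13 - m 14 - m 3 - m 4 - m 6 + m 63 + m 65 + m 41 + m 43 + m 15 - m 16 + m 21 - m 28
          + m 29 - m 30
  c ₅ ₄ = - m 14 - m 1 + m 68 + m 61 + m 37 - m 39 + m 43 - m 27 - m 28
  c ₁ ₅ = - ℓ⁻² • m 8 - ℓ⁻² • m 9 - ℓ⁻² • m 34 + m 2 + m 89 + m 99 + m 54 + m 64 + m 40 - m 47
          + m 31
  c ₂ ₅ = m 96 + m 97 + m 98 - m 49 + m 51 + m 53 - m 33 + m 17
  c ₃ ₅ = - ℓ⁻² • m 8 - ℓ⁻² • m 9 - ℓ⁻² • m 46 - ℓ⁻² • m 32 + m 3 + m 94 + m 95 + m 71 - m 55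
          + m 35 + m 48
  c ₄ ₅ = m 92 + m 93 + m 49 + m 57 + m 59 + m 33 - m 17
  c ₅ ₅ = ℓ⁻¹ • m 8 + ℓ⁻¹ • m 9 + m 91 - m 35 - m 31

  scheme : Scheme K.Carrier 5 5 5 99
  scheme = record { products = products ; outputs = c }

{-# OPTIONS --safe #-}
-- Every scalar of the scheme is, up to sign, a power of ℓ, so both sides of each of the 25
-- identities expand into signed sums of monomials ℓᵉ aᵢⱼ bₖₗ.  Expansion, and deletion of
-- pairs of opposite monomials, preserve the value in any associative algebra; that nothing
-- is left of the difference of the two sides is then a finite computation.
module Submission where

open import Defs
open import Algebra.Bundles using (CommutativeMonoid; CommutativeRing; Ring)
open import Algebra.Morphism.Structures using (IsRingHomomorphism)
import Algebra.Properties.CommutativeSemigroup as CommutativeSemigroupProperties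
import Algebra.Properties.Monoid.Mult.TCOptimised as Multiple
import Algebra.Properties.Monoid.Sum as MonoidSum
import Algebra.Properties.Ring as RingProperties
import Algebra.Properties.Semiring.Exp.TCOptimised as Exponentiation
open import Data.Bool.Base using (T)
open import Data.Fin.Base using (Fin; zero; suc)
import Data.Fin.Properties as Fin
open import Data.Integer.Base as ℤ using (ℤ; +_; -[1+_]; _⊖_)
import Data.Integer.Properties as ℤ
open import Data.List.Base as List using (List; []; _∷_; _++_; null)
open import Data.Nat.Base as ℕ using (ℕ; zero; suc)
import Data.Nat.Properties as ℕ
open import Data.Product.Base using (_×_; _,_; map₁)
import Data.Product.Properties as Product
open import Data.Sign.Base as Sign using (Sign)
import Data.Sign.Properties as Sign
open import Data.Unit.Base using (⊤; tt)
open import Data.Vec.Base as Vec using (lookup)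
import Data.Vec.Properties as Vec
open import Function.Base using (_∘_)
open import Level using (0ℓ; Level)
open import Relation.Binary.Definitions using (DecidableEquality)
open import Relation.Binary.PropositionalEquality.Core as ≡ using (_≡_)
import Relation.Binary.Reasoning.Setoid as SetoidReasoning
open import Relation.Nullary.Decidable using (yes; no; toWitness; T?)

private
  variable
    k e r e′ : Level
    X Y : Set
    m n p t : ℕ

-- Formal signed sums of monomials in `ℓ` and the variables.

-- (s , i) stands for s ℓⁱ.
SignedPower : Set
SignedPower = Sign × ℤ

infixl 7 _∙_
_∙_ : SignedPower → SignedPower → SignedPower
(s , i) ∙ (t , j) = s Sign.* t , i ℤ.+ j

opposite : SignedPower → SignedPower
opposite = map₁ Sign.opposite

Terms : Set → Set
Terms X = List (SignedPower × X)

scale : SignedPower → Terms X → Terms X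
scale c = List.map (map₁ (c ∙_))

-- Encoded as scaling by the monomial `- ℓ⁰`, so that its value is an instance of that of `scale`.
negate : Terms X → Terms X
negate = scale (Sign.- , + 0)

multiply : Terms X → Terms Y → Terms (X × Y)
multiply = List.cartesianProductWith λ (c , x) (d , y) → c ∙ d , x , y

-- A scalar e of a linear combination with integer scalars stands for ℓᵉ.
expand : (X → Terms Y) → Linear ℤ X → Terms Y
expand f (var x) = f x
expand f (u + v) = expand f u ++ expand f v
expand f (u - v) = expand f u ++ negate (expand f v)
expand f (- u)   = negate (expand f u)
expand f (i • u) = scale (Sign.+ , i) (expand f u)

unit : X → Terms X
unit x = ((Sign.+ , + 0) , x) ∷ []

-- Cancellation of opposite monomials.

module Cancellation (_≟_ : DecidableEquality X) where

  _≟ₜ_ : DecidableEquality (SignedPower × X)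
  _≟ₜ_ = Product.≡-dec (Product.≡-dec Sign._≟_ ℤ._≟_) _≟_

  -- Each new term deletes at most one opposite term, so multiplicities are respected.
  insert : SignedPower × X → Terms X → Terms X
  insert t [] = t ∷ []
  insert t (u ∷ us) with map₁ opposite t ≟ₜ u
  ... | yes _ = us
  ... | no  _ = u ∷ insert t us

  cancel : Terms X → Terms X
  cancel = List.foldr insert []

-- Schemes with integer exponents as scalars.

Entry : ℕ → ℕ → Set
Entry m n = Fin m × Fin n

-- Monomials keep the left entry and the right entry as an ordered pair, as entries need not
-- commute.
productTerms : Product ℤ m n p → Terms (Entry m n × Entry n p)
productTerms (u ⊗ v) = multiply (expand unit u) (expand unit v)

module _ (σ : Scheme ℤ m n p t) (i : Fin m) (j : Fin p) where
  open Scheme σ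

  outputTerms matrixProductTerms differenceTerms : Terms (Entry m n × Entry n p)
  outputTerms        = expand (productTerms ∘ lookup products) (outputs i j)
  matrixProductTerms = List.tabulate λ h → (Sign.+ , + 0) , (i , h) , (h , j)
  differenceTerms    = outputTerms ++ negate matrixProductTerms

_≟ₑ_ : DecidableEquality (Entry m n × Entry n p)
_≟ₑ_ = Product.≡-dec (Product.≡-dec Fin._≟_ Fin._≟_) (Product.≡-dec Fin._≟_ Fin._≟_)

open Cancellation using (cancel)

-- A list built by `cancel` never holds a monomial together with its opposite, so it is empty
-- exactly when all integer coefficients of the difference vanish. The condition mentions no ring
-- and is decided by evaluation.
FormallyCorrect : Scheme ℤ m n p t → Set
FormallyCorrect σ = ∀ i j → T (null (cancel _≟ₑ_ (differenceTerms σ i j)))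

mapLinear : {S : Set k} → (ℤ → S) → Linear ℤ X → Linear S X
mapLinear f (var x) = var x
mapLinear f (u + v) = mapLinear f u + mapLinear f v
mapLinear f (u - v) = mapLinear f u - mapLinear f v
mapLinear f (- u)   = - mapLinear f u
mapLinear f (i • u) = f i • mapLinear f u

mapProduct : {S : Set k} → (ℤ → S) → Product ℤ m n p → Product S m n p
mapProduct f (u ⊗ v) = mapLinear f u ⊗ mapLinear f v

-- Integer powers of an invertible scalar.

module Powers (K : CommutativeRing k e) (ℓ ℓ⁻¹ : CommutativeRing.Carrier K) where
  open CommutativeRing K using (Carrier; semiring)
  open Exponentiation semiring using (_^_)
  private module K = CommutativeRing K

  power : ℤ → Carrier
  power (+ n)    = ℓ ^ n
  power -[1+ n ] = ℓ⁻¹ ^ suc n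

  signedPower : SignedPower → Carrier
  signedPower (Sign.+ , i) = power i
  signedPower (Sign.- , i) = K.- power i

  module _ (ℓ*ℓ⁻¹≈1 : ℓ K.* ℓ⁻¹ K.≈ K.1#) where
    open K using (_≈_; _*_; 1#)
    open Exponentiation semiring using (^-homo-*)
    open Multiple K.*-monoid using () renaming (1+× to ^-suc)
    open CommutativeSemigroupProperties K.*-commutativeSemigroup using (interchange)
    open RingProperties K.ring using (-‿distribˡ-*; -‿distribʳ-*; -‿involutive)
    open SetoidReasoning K.setoid

    -- Exponents of mixed sign add through `⊖`. Each common successor is absorbed by one factor
    -- `ℓ * ℓ⁻¹`; this is where invertibility of `ℓ` enters.
    power-⊖ : ∀ m n → power (m ⊖ n) ≈ ℓ ^ m * ℓ⁻¹ ^ n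
    power-⊖ zero    zero    = K.sym (K.*-identityˡ 1#)
    power-⊖ zero    (suc n) = K.sym (K.*-identityˡ _)
    power-⊖ (suc m) zero    = K.sym (K.*-identityʳ _)
    power-⊖ (suc m) (suc n) = begin
      power (suc m ⊖ suc n)              ≡⟨ ≡.cong power (ℤ.[1+m]⊖[1+n]≡m⊖n m n) ⟩
      power (m ⊖ n)                      ≈⟨ power-⊖ m n ⟩
      ℓ ^ m * ℓ⁻¹ ^ n                    ≈⟨ K.*-identityˡ _ ⟨
      1# * (ℓ ^ m * ℓ⁻¹ ^ n)             ≈⟨ K.*-congʳ ℓ*ℓ⁻¹≈1 ⟨
      (ℓ * ℓ⁻¹) * (ℓ ^ m * ℓ⁻¹ ^ n)      ≈⟨ interchange ℓ ℓ⁻¹ (ℓ ^ m) (ℓ⁻¹ ^ n) ⟩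
      (ℓ * ℓ ^ m) * (ℓ⁻¹ * ℓ⁻¹ ^ n)      ≈⟨ K.*-cong (^-suc m ℓ) (^-suc n ℓ⁻¹) ⟨
      ℓ ^ suc m * ℓ⁻¹ ^ suc n            ∎

    power-+ : ∀ i j → power (i ℤ.+ j) ≈ power i * power j
    power-+ (+ m)    (+ n)    = ^-homo-* ℓ m n
    power-+ (+ m)    -[1+ n ] = power-⊖ m (suc n)
    power-+ -[1+ m ] (+ n)    = K.trans (power-⊖ n (suc m)) (K.*-comm _ _)
    power-+ -[1+ m ] -[1+ n ] = begin
      ℓ⁻¹ ^ suc (suc (m ℕ.+ n))  ≡⟨ ≡.cong (λ q → ℓ⁻¹ ^ suc q) (ℕ.+-suc m n) ⟨
      ℓ⁻¹ ^ (suc m ℕ.+ suc n)    ≈⟨ ^-homo-* ℓ⁻¹ (suc m) (suc n) ⟩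
      ℓ⁻¹ ^ suc m * ℓ⁻¹ ^ suc n  ∎

    signedPower-∙ : ∀ c d → signedPower (c ∙ d) ≈ signedPower c * signedPower d
    signedPower-∙ (Sign.+ , i) (Sign.+ , j) = power-+ i j
    signedPower-∙ (Sign.+ , i) (Sign.- , j) =
      K.trans (K.-‿cong (power-+ i j)) (-‿distribʳ-* _ _)
    signedPower-∙ (Sign.- , i) (Sign.+ , j) =
      K.trans (K.-‿cong (power-+ i j)) (-‿distribˡ-* _ _)
    signedPower-∙ (Sign.- , i) (Sign.- , j) = begin
      power (i ℤ.+ j)                   ≈⟨ power-+ i j ⟩
      power i * power j                 ≈⟨ -‿involutive _ ⟨
      K.- (K.- (power i * power j))     ≈⟨ K.-‿cong (-‿distribʳ-* _ _) ⟩
      K.- (power i * K.- power j)       ≈⟨ -‿distribˡ-* _ _ ⟩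
      K.- power i * K.- power j         ∎

  signedPower-opposite : ∀ c → signedPower (opposite c) K.≈ K.- signedPower c
  signedPower-opposite (Sign.+ , i) = K.refl
  signedPower-opposite (Sign.- , i) = K.sym (-‿involutive _)
    where open RingProperties K.ring using (-‿involutive)

-- Evaluation of formal sums in an associative algebra.

module Soundness {K : CommutativeRing k e} (R : AssociativeAlgebra K r e′)
                 (ℓ ℓ⁻¹ : CommutativeRing.Carrier K)
                 (ℓ*ℓ⁻¹≈1 : CommutativeRing._≈_ K (CommutativeRing._*_ K ℓ ℓ⁻¹)
                                                 (CommutativeRing.1# K)) where
  private
    module K = CommutativeRing K
    module R = Ring (AssociativeAlgebra.ring R)
  open AssociativeAlgebra R using (η; isRingHomomorphism; central)
  open IsRingHomomorphism isRingHomomorphism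
    using (⟦⟧-cong; *-homo; 1#-homo; -‿homo)
  open R using (Carrier; _≈_; 0#; 1#; _*_)
  open RingProperties (AssociativeAlgebra.ring R)
    using (-1*x≈-x; -‿distribˡ-*; x∙y⁻¹≈ε⇒x≈y)
  open CommutativeSemigroupProperties
    (CommutativeMonoid.commutativeSemigroup R.+-commutativeMonoid)
    using (x∙yz≈y∙xz)
  open MonoidSum R.+-monoid using (sum-syntax)
  open Evaluation R
  open Powers K ℓ ℓ⁻¹
  open SetoidReasoning R.setoid

  scalar : SignedPower → Carrier
  scalar c = η (signedPower c)

  scalar-∙ : ∀ c d → scalar (c ∙ d) ≈ scalar c * scalar d
  scalar-∙ c d = R.trans (⟦⟧-cong (signedPower-∙ ℓ*ℓ⁻¹≈1 c d)) (*-homo _ _)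

  scalar-opposite : ∀ c → scalar (opposite c) ≈ R.- scalar c
  scalar-opposite c = R.trans (⟦⟧-cong (signedPower-opposite c)) (-‿homo _)

  scalar-minusOne : scalar (Sign.- , + 0) ≈ R.- 1#
  scalar-minusOne = R.trans (-‿homo _) (R.-‿cong 1#-homo)

  evalTerm : (X → Carrier) → SignedPower × X → Carrier
  evalTerm ρ (c , x) = scalar c * ρ x

  evalTerms : (X → Carrier) → Terms X → Carrier
  evalTerms ρ []       = 0#
  evalTerms ρ (t ∷ ts) = evalTerm ρ t R.+ evalTerms ρ ts

  module _ (ρ : X → Carrier) where

    evalTerms-unit : ∀ x → ρ x ≈ evalTerms ρ (unit x)
    evalTerms-unit x = begin
      ρ x                                   ≈⟨ R.*-identityˡ _ ⟨
      1# * ρ x                              ≈⟨ R.*-congʳ 1#-homo ⟨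
      scalar (Sign.+ , + 0) * ρ x           ≈⟨ R.+-identityʳ _ ⟨
      scalar (Sign.+ , + 0) * ρ x R.+ 0#    ∎

    evalTerms-++ : ∀ ts us → evalTerms ρ (ts ++ us) ≈ evalTerms ρ ts R.+ evalTerms ρ us
    evalTerms-++ []       us = R.sym (R.+-identityˡ _)
    evalTerms-++ (t ∷ ts) us =
      R.trans (R.+-congˡ (evalTerms-++ ts us)) (R.sym (R.+-assoc _ _ _))

    evalTerms-scale : ∀ c ts → evalTerms ρ (scale c ts) ≈ scalar c * evalTerms ρ ts
    evalTerms-scale c []             = R.sym (R.zeroʳ _)
    evalTerms-scale c ((d , x) ∷ ts) = begin
      scalar (c ∙ d) * ρ x R.+ evalTerms ρ (scale c ts)
        ≈⟨ R.+-cong (R.*-congʳ (scalar-∙ c d)) (evalTerms-scale c ts) ⟩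
      scalar c * scalar d * ρ x R.+ scalar c * evalTerms ρ ts
        ≈⟨ R.+-congʳ (R.*-assoc _ _ _) ⟩
      scalar c * (scalar d * ρ x) R.+ scalar c * evalTerms ρ ts
        ≈⟨ R.distribˡ _ _ _ ⟨
      scalar c * (scalar d * ρ x R.+ evalTerms ρ ts) ∎

    evalTerms-negate : ∀ ts → evalTerms ρ (negate ts) ≈ R.- evalTerms ρ ts
    evalTerms-negate ts = begin
      evalTerms ρ (negate ts)                ≈⟨ evalTerms-scale (Sign.- , + 0) ts ⟩
      scalar (Sign.- , + 0) * evalTerms ρ ts ≈⟨ R.*-congʳ scalar-minusOne ⟩
      R.- 1# * evalTerms ρ ts                ≈⟨ -1*x≈-x _ ⟩
      R.- evalTerms ρ ts                     ∎

    evalTerms-tabulate : (f : Fin n → X) →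
      evalTerms ρ (List.tabulate λ h → (Sign.+ , + 0) , f h) ≈ ∑[ h < n ] ρ (f h)
    evalTerms-tabulate {n = zero}  f = R.refl
    evalTerms-tabulate {n = suc n} f =
      R.+-cong (R.trans (R.*-congʳ 1#-homo) (R.*-identityˡ _))
               (evalTerms-tabulate (f ∘ suc))

    module _ (_≟_ : DecidableEquality X) where
      open Cancellation _≟_ using (insert; _≟ₜ_)

      evalTerms-insert : ∀ t ts → evalTerms ρ (insert t ts) ≈ evalTerm ρ t R.+ evalTerms ρ ts
      evalTerms-insert t [] = R.refl
      evalTerms-insert t@(c , x) (u ∷ us) with map₁ opposite t ≟ₜ u
      -- The match makes `u` the opposite of `t`, so the deleted term is restored by adding `v` and
      -- `- v`.
      ... | yes ≡.refl = begin
        evalTerms ρ us                                    ≈⟨ R.+-identityˡ _ ⟨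
        0# R.+ evalTerms ρ us                             ≈⟨ R.+-congʳ (R.-‿inverseʳ _) ⟨
        v R.+ R.- v R.+ evalTerms ρ us                    ≈⟨ R.+-assoc _ _ _ ⟩
        v R.+ (R.- v R.+ evalTerms ρ us)
          ≈⟨ R.+-congˡ (R.+-congʳ (-‿distribˡ-* _ _)) ⟩
        v R.+ (R.- scalar c * ρ x R.+ evalTerms ρ us)
          ≈⟨ R.+-congˡ (R.+-congʳ (R.*-congʳ (scalar-opposite c))) ⟨
        v R.+ (scalar (opposite c) * ρ x R.+ evalTerms ρ us) ∎
        where v = scalar c * ρ x
      ... | no _ = R.trans (R.+-congˡ (evalTerms-insert t us)) (x∙yz≈y∙xz _ _ _)

      evalTerms-cancel : ∀ ts → evalTerms ρ (cancel _≟_ ts) ≈ evalTerms ρ ts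
      evalTerms-cancel []       = R.refl
      evalTerms-cancel (t ∷ ts) =
        R.trans (evalTerms-insert t (cancel _≟_ ts)) (R.+-congˡ (evalTerms-cancel ts))

  evalTerms-null : (ρ : X → Carrier) → ∀ ts → T (null ts) → evalTerms ρ ts ≈ 0#
  evalTerms-null ρ [] _ = R.refl

  module _ (ρ : X → Carrier) (τ : Y → Carrier) where

    private
      ρτ : X × Y → Carrier
      ρτ (x , y) = ρ x * τ y

    -- The scalar of the right factor has to pass `ρ x`, which centrality permits; `ρ x` and `τ y`
    -- stay in order throughout.
    evalTerm-* : ∀ c x d y →
                 evalTerm ρτ (c ∙ d , x , y) ≈ evalTerm ρ (c , x) * evalTerm τ (d , y)
    evalTerm-* c x d y = begin
      scalar (c ∙ d) * (ρ x * τ y)          ≈⟨ R.*-congʳ (scalar-∙ c d) ⟩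
      scalar c * scalar d * (ρ x * τ y)     ≈⟨ R.*-assoc _ _ _ ⟩
      scalar c * (scalar d * (ρ x * τ y))   ≈⟨ R.*-congˡ (R.*-assoc _ _ _) ⟨
      scalar c * (scalar d * ρ x * τ y)     ≈⟨ R.*-congˡ (R.*-congʳ (central _ _)) ⟩
      scalar c * (ρ x * scalar d * τ y)     ≈⟨ R.*-congˡ (R.*-assoc _ _ _) ⟩
      scalar c * (ρ x * (scalar d * τ y))   ≈⟨ R.*-assoc _ _ _ ⟨
      scalar c * ρ x * (scalar d * τ y)     ∎

    evalTerms-multiply : ∀ ts us →
                         evalTerms ρτ (multiply ts us) ≈ evalTerms ρ ts * evalTerms τ us
    evalTerms-multiply []             us = R.sym (R.zeroˡ _)
    evalTerms-multiply ((c , x) ∷ ts) us = begin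
      evalTerms ρτ (List.map (λ (d , y) → c ∙ d , x , y) us ++ multiply ts us)
        ≈⟨ evalTerms-++ ρτ (List.map _ us) _ ⟩
      evalTerms ρτ (List.map (λ (d , y) → c ∙ d , x , y) us)
        R.+ evalTerms ρτ (multiply ts us)
        ≈⟨ R.+-cong (row us) (evalTerms-multiply ts us) ⟩
      evalTerm ρ (c , x) * evalTerms τ us R.+ evalTerms ρ ts * evalTerms τ us
        ≈⟨ R.distribʳ _ _ _ ⟨
      (evalTerm ρ (c , x) R.+ evalTerms ρ ts) * evalTerms τ us ∎
      where
      row : ∀ us → evalTerms ρτ (List.map (λ (d , y) → c ∙ d , x , y) us)
                   ≈ evalTerm ρ (c , x) * evalTerms τ us
      row []             = R.sym (R.zeroʳ _)
      row ((d , y) ∷ us) =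
        R.trans (R.+-cong (evalTerm-* c x d y) (row us)) (R.sym (R.distribˡ _ _ _))

  module _ {ρ : X → Carrier} {τ : Y → Carrier} {f : X → Terms Y}
           (ρ≈f : ∀ x → ρ x ≈ evalTerms τ (f x)) where

    -- Stated for an arbitrary substitution `f` because it serves twice: with `unit` for the two
    -- factors of a product, and with `productTerms` for the outputs.
    evalLinear-expand : ∀ u → evalLinear ρ (mapLinear power u) ≈ evalTerms τ (expand f u)
    evalLinear-expand (var x) = ρ≈f x
    evalLinear-expand (u + v) =
      R.trans (R.+-cong (evalLinear-expand u) (evalLinear-expand v))
              (R.sym (evalTerms-++ τ (expand f u) _))
    evalLinear-expand (u - v) =
      R.trans (R.+-cong (evalLinear-expand u)
                        (R.trans (R.-‿cong (evalLinear-expand v))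
                                 (R.sym (evalTerms-negate τ (expand f v)))))
              (R.sym (evalTerms-++ τ (expand f u) _))
    evalLinear-expand (- u)   =
      R.trans (R.-‿cong (evalLinear-expand u)) (R.sym (evalTerms-negate τ (expand f u)))
    evalLinear-expand (i • u) =
      R.trans (R.*-congˡ (evalLinear-expand u))
              (R.sym (evalTerms-scale τ (Sign.+ , i) (expand f u)))

  -- Evaluation of whole schemes.

  module _ (A : Matrix m n) (B : Matrix n p) where

    -- The inner indices `h` and `h′` are independent, since multiplying out the factors also yields
    -- monomials foreign to the matrix product; these must cancel.
    entryProduct : Entry m n × Entry n p → Carrier
    entryProduct ((i , h) , (h′ , j)) = A i h * B h′ j

    evalProduct-terms : ∀ q → evalProduct A B (mapProduct power q)
                              ≈ evalTerms entryProduct (productTerms q)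
    evalProduct-terms (u ⊗ v) = begin
      evalLinear _ (mapLinear power u) * evalLinear _ (mapLinear power v)
        ≈⟨ R.*-cong (evalLinear-expand (evalTerms-unit _) u)
                    (evalLinear-expand (evalTerms-unit _) v) ⟩
      evalTerms _ (expand unit u) * evalTerms _ (expand unit v)
        ≈⟨ evalTerms-multiply _ _ (expand unit u) (expand unit v) ⟨
      evalTerms entryProduct (productTerms (u ⊗ v)) ∎

    -- All cancellation is checked on `σ′`, whose scalars are integers; `σ` is only compared with it
    -- through `power`. One finite check thus serves every `K` and every algebra.
    evalScheme-correct : (σ : Scheme K.Carrier m n p t) (σ′ : Scheme ℤ m n p t) →
      Scheme.products σ ≡ Vec.map (mapProduct power) (Scheme.products σ′) →
      (∀ i j → Scheme.outputs σ i j ≡ mapLinear power (Scheme.outputs σ′ i j)) →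
      FormallyCorrect σ′ → ∀ i j → evalScheme A B σ i j ≈ matrixProduct A B i j
    evalScheme-correct σ σ′ products≡ outputs≡ correct i j = begin
      evalLinear (evalProduct A B ∘ lookup σ.products) (σ.outputs i j)
        ≡⟨ ≡.cong (evalLinear _) (outputs≡ i j) ⟩
      evalLinear (evalProduct A B ∘ lookup σ.products) (mapLinear power (σ′.outputs i j))
        ≈⟨ evalLinear-expand product≈ (σ′.outputs i j) ⟩
      evalTerms entryProduct (outputTerms σ′ i j)
        -- The formal check speaks of one list becoming empty, so the equality is reduced to a
        -- vanishing difference.
        ≈⟨ x∙y⁻¹≈ε⇒x≈y _ _ difference≈0 ⟩
      evalTerms entryProduct (matrixProductTerms σ′ i j)
        ≈⟨ evalTerms-tabulate entryProduct (λ h → (i , h) , (h , j)) ⟩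
      matrixProduct A B i j ∎
      where
      module σ = Scheme σ
      module σ′ = Scheme σ′

      product≈ : ∀ q → evalProduct A B (lookup σ.products q)
                       ≈ evalTerms entryProduct (productTerms (lookup σ′.products q))
      product≈ q = begin
        evalProduct A B (lookup σ.products q)
          ≡⟨ ≡.cong (λ qs → evalProduct A B (lookup qs q)) products≡ ⟩
        evalProduct A B (lookup (Vec.map (mapProduct power) σ′.products) q)
          ≡⟨ ≡.cong (evalProduct A B) (Vec.lookup-map q (mapProduct power) σ′.products) ⟩
        evalProduct A B (mapProduct power (lookup σ′.products q))
          ≈⟨ evalProduct-terms (lookup σ′.products q) ⟩
        evalTerms entryProduct (productTerms (lookup σ′.products q)) ∎

      difference≈0 : evalTerms entryProduct (outputTerms σ′ i j)
                     R.- evalTerms entryProduct (matrixProductTerms σ′ i j) ≈ 0#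
      difference≈0 = begin
        evalTerms entryProduct (outputTerms σ′ i j)
          R.- evalTerms entryProduct (matrixProductTerms σ′ i j)
          ≈⟨ R.+-congˡ (evalTerms-negate entryProduct (matrixProductTerms σ′ i j)) ⟨
        evalTerms entryProduct (outputTerms σ′ i j)
          R.+ evalTerms entryProduct (negate (matrixProductTerms σ′ i j))
          ≈⟨ evalTerms-++ entryProduct (outputTerms σ′ i j) _ ⟨
        evalTerms entryProduct (differenceTerms σ′ i j)
          ≈⟨ evalTerms-cancel entryProduct _≟ₑ_ (differenceTerms σ′ i j) ⟨
        evalTerms entryProduct (cancel _≟ₑ_ (differenceTerms σ′ i j))
          ≈⟨ evalTerms-null entryProduct (cancel _≟ₑ_ (differenceTerms σ′ i j)) (correct i j) ⟩
        0# ∎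

-- The concrete scheme and its finite verification.

-- Scheme99 uses only the multiplication of its scalars.  Exponents multiply by addition; the
-- other operations are junk, and declaring all elements equal makes the ring laws vacuous.
exponentRing : CommutativeRing 0ℓ 0ℓ
exponentRing = record
  { Carrier = ℤ
  ; _≈_     = λ _ _ → ⊤
  ; _+_     = ℤ._+_
  ; _*_     = ℤ._+_
  ; -_      = ℤ.-_
  ; 0#      = + 0
  ; 1#      = + 0
  ; isCommutativeRing = record
    { isRing = record
      { +-isAbelianGroup = record
        { isGroup = record
          { isMonoid = record
            { isSemigroup = record
              { isMagma = record
                { isEquivalence = record {} ; ∙-cong = λ _ _ → tt }
              ; assoc = λ _ _ _ → tt
              }
            ; identity = (λ _ → tt) , (λ _ → tt)
            }
          ; inverse = (λ _ → tt) , (λ _ → tt)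
          ; ⁻¹-cong = λ _ → tt
          }
        ; comm = λ _ _ → tt
        }
      ; *-cong     = λ _ _ → tt
      ; *-assoc    = λ _ _ _ → tt
      ; *-identity = (λ _ → tt) , (λ _ → tt)
      ; distrib    = (λ _ _ _ → tt) , (λ _ _ _ → tt)
      }
    ; *-comm = λ _ _ → tt
    }
  }

-- `ℓ` becomes the exponent 1 and `ℓ⁻¹` the exponent -1, so `ℓ²` and `ℓ⁻²` compute to 2 and -2.
exponentScheme : Scheme ℤ 5 5 5 99
exponentScheme = Scheme99.scheme exponentRing (+ 1) -[1+ 0 ]

exponentScheme-correct : FormallyCorrect exponentScheme
-- Type checking `tt` runs the decision procedure, that is, the expansion and cancellation for all
-- 25 index pairs.
exponentScheme-correct = toWitness {a? = Fin.all? λ i → Fin.all? λ j → T? _} tt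

-- Transfer to an arbitrary coefficient ring.

module _ (K : CommutativeRing k e) (ℓ ℓ⁻¹ : CommutativeRing.Carrier K) where
  open Powers K ℓ ℓ⁻¹ using (power)

  -- Definitional, because the chosen exponentiation reduces `ℓ ^ 1` to `ℓ` and `ℓ ^ 2` to `ℓ * ℓ`,
  -- with no trailing factor `1#`, and likewise for `ℓ⁻¹`.
  products-mapped : Scheme99.products K ℓ ℓ⁻¹
                    ≡ Vec.map (mapProduct power) (Scheme.products exponentScheme)
  products-mapped = ≡.refl

  outputs-mapped : ∀ i j → Scheme99.c K ℓ ℓ⁻¹ i j
                           ≡ mapLinear power (Scheme.outputs exponentScheme i j)
  -- `c` is defined by matching on indices, so both sides reduce only at concrete `i` and `j`.
  outputs-mapped ₁ ₁ = ≡.refl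
  outputs-mapped ₁ ₂ = ≡.refl
  outputs-mapped ₁ ₃ = ≡.refl
  outputs-mapped ₁ ₄ = ≡.refl
  outputs-mapped ₁ ₅ = ≡.refl
  outputs-mapped ₂ ₁ = ≡.refl
  outputs-mapped ₂ ₂ = ≡.refl
  outputs-mapped ₂ ₃ = ≡.refl
  outputs-mapped ₂ ₄ = ≡.refl
  outputs-mapped ₂ ₅ = ≡.refl
  outputs-mapped ₃ ₁ = ≡.refl
  outputs-mapped ₃ ₂ = ≡.refl
  outputs-mapped ₃ ₃ = ≡.refl
  outputs-mapped ₃ ₄ = ≡.refl
  outputs-mapped ₃ ₅ = ≡.refl
  outputs-mapped ₄ ₁ = ≡.refl
  outputs-mapped ₄ ₂ = ≡.refl
  outputs-mapped ₄ ₃ = ≡.refl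
  outputs-mapped ₄ ₄ = ≡.refl
  outputs-mapped ₄ ₅ = ≡.refl
  outputs-mapped ₅ ₁ = ≡.refl
  outputs-mapped ₅ ₂ = ≡.refl
  outputs-mapped ₅ ₃ = ≡.refl
  outputs-mapped ₅ ₄ = ≡.refl
  outputs-mapped ₅ ₅ = ≡.refl

mainTheorem1 : {k e r e′ : Level} (K : CommutativeRing k e) → let open CommutativeRing K in
    (ℓ ℓ⁻¹ : Carrier) → ℓ * ℓ⁻¹ ≈ 1# →
    ComputesMatrixProduct K r e′ (Scheme99.scheme K ℓ ℓ⁻¹)
mainTheorem1 K ℓ ℓ⁻¹ ℓ*ℓ⁻¹≈1 R A B =
  evalScheme-correct A B (Scheme99.scheme K ℓ ℓ⁻¹) exponentScheme
    (products-mapped K ℓ ℓ⁻¹) (outputs-mapped K ℓ ℓ⁻¹) exponentScheme-correct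
  where open Soundness R ℓ ℓ⁻¹ ℓ*ℓ⁻¹≈1
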